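{- Let $m\ge 2$ be an integer and let $H$ be a connected graph of order at least $2$. The Cartesian product $K_m \,\square\, H$ is well-dominated if and only if either $m \neq 3$ and $H=K_m$, or $m=3$ and $H \in \{K_3,P_3\}$.
   Context: All graphs are finite, simple and undirected. A set $D\subseteq V(X)$ is a dominating set of a graph $X$ if every vertex of $X$ is in $D$ or adjacent to a vertex of $D$; it is minimal if no proper subset is dominating. $\gamma(X)$ is the minimum size of a dominating set, $\Gamma(X)$ the maximum size of a minimal dominating set; $X$ is well-dominated if $\gamma(X)=\Gamma(X)$. The Cartesian product $G\,\square\, H$ has vertex set $V(G)\times V(H)$, with $(g_1,h_1)$ adjacent to $(g_2,h_2)$ iff either $g_1=g_2$ and $h_1h_2\in E(H)$, or $h_1=h_2$ and $g_1g_2\in E(G)$. $K_m$ is the complete graph of order $m$ and $P_3$ the path on $3$ vertices; $H=K_m$ etc. means isomorphism. -}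

module Defs where

open import Data.Nat using (ℕ; suc; _≤_; _*_)
open import Data.Fin using (Fin; zero; suc; toℕ; combine; remQuot; _≟_)
open import Data.Fin.Subset using (Subset; _∈_; _⊂_; ∣_∣)
open import Data.Bool using (Bool; true; false; _∨_; _∧_; T; not)
open import Data.Product using (Σ; ∃; _×_; _,_)
open import Data.Sum using (_⊎_)
open import Data.Empty using (⊥; ⊥-elim)
open import Data.List using (List; []; _∷_)
open import Relation.Nullary using (¬_; yes; no)
open import Relation.Nullary.Decidable using (⌊_⌋)
open import Relation.Binary.PropositionalEquality using (_≡_; refl; cong) renaming (sym to ≡-sym)
open import Function.Bundles using (_↔_; Inverse)

record Graph : Set where
  field
    order : ℕ
    adj   : Fin order → Fin order → Bool
    sym   : ∀ u v → adj u v ≡ adj v u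
    irrefl : ∀ v → adj v v ≡ false

open Graph public

Adj : (X : Graph) → Fin (order X) → Fin (order X) → Set
Adj X u v = T (adj X u v)

Dominating : (X : Graph) → Subset (order X) → Set
Dominating X D = ∀ v → v ∈ D ⊎ (∃ λ u → u ∈ D × Adj X u v)

MinimalDominating : (X : Graph) → Subset (order X) → Set
MinimalDominating X D = Dominating X D × (∀ D′ → D′ ⊂ D → ¬ Dominating X D′)

IsDominationNumber : (X : Graph) → ℕ → Set
IsDominationNumber X k =
  (∃ λ D → Dominating X D × ∣ D ∣ ≡ k) × (∀ D → Dominating X D → k ≤ ∣ D ∣)

IsUpperDominationNumber : (X : Graph) → ℕ → Set
IsUpperDominationNumber X k =
  (∃ λ D → MinimalDominating X D × ∣ D ∣ ≡ k) × (∀ D → MinimalDominating X D → ∣ D ∣ ≤ k)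

WellDominated : Graph → Set
WellDominated X = ∀ g G → IsDominationNumber X g → IsUpperDominationNumber X G → g ≡ G

data Walk (X : Graph) : Fin (order X) → Fin (order X) → Set where
  here : ∀ {v} → Walk X v v
  step : ∀ {u v w} → Adj X u v → Walk X v w → Walk X u w

Connected : Graph → Set
Connected X = ∀ u v → Walk X u v

record _≅_ (X Y : Graph) : Set where
  field
    bij : Fin (order X) ↔ Fin (order Y)
    pres : ∀ u v → adj Y (Inverse.to bij u) (Inverse.to bij v) ≡ adj X u v

eqB-refl : ∀ {n} (v : Fin n) → ⌊ v ≟ v ⌋ ≡ true
eqB-refl v with v ≟ v
... | yes _ = refl
... | no q = ⊥-elim (q refl)

eqB-sym : ∀ {n} (u v : Fin n) → ⌊ u ≟ v ⌋ ≡ ⌊ v ≟ u ⌋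
eqB-sym u v with u ≟ v | v ≟ u
... | yes _ | yes _ = refl
... | no _  | no _  = refl
... | yes p | no q  = ⊥-elim (q (≡-sym p))
... | no p  | yes q = ⊥-elim (p (≡-sym q))

K : ℕ → Graph
K m = record
  { order = m
  ; adj = λ u v → not ⌊ u ≟ v ⌋
  ; sym = λ u v → cong not (eqB-sym u v)
  ; irrefl = λ v → cong not (eqB-refl v)
  }

p3adj : Fin 3 → Fin 3 → Bool
p3adj zero (suc zero) = true
p3adj (suc zero) zero = true
p3adj (suc zero) (suc (suc zero)) = true
p3adj (suc (suc zero)) (suc zero) = true
p3adj _ _ = false

P₃ : Graph
P₃ = record
  { order = 3
  ; adj = p3adj
  ; sym = λ { zero zero → refl ; zero (suc zero) → refl ; zero (suc (suc zero)) → refl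
            ; (suc zero) zero → refl ; (suc zero) (suc zero) → refl ; (suc zero) (suc (suc zero)) → refl
            ; (suc (suc zero)) zero → refl ; (suc (suc zero)) (suc zero) → refl ; (suc (suc zero)) (suc (suc zero)) → refl }
  ; irrefl = λ { zero → refl ; (suc zero) → refl ; (suc (suc zero)) → refl }
  }

-- Cartesian product G □ H on Fin (order G * order H); the vertex (g , h)
-- is encoded as combine g h (inverse remQuot)
pairAdj : (G H : Graph) → Fin (order G) × Fin (order H) → Fin (order G) × Fin (order H) → Bool
pairAdj G H (g₁ , h₁) (g₂ , h₂) = (⌊ g₁ ≟ g₂ ⌋ ∧ adj H h₁ h₂) ∨ (⌊ h₁ ≟ h₂ ⌋ ∧ adj G g₁ g₂)

pairAdj-sym : (G H : Graph) → ∀ p q → pairAdj G H p q ≡ pairAdj G H q p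
pairAdj-sym G H (g₁ , h₁) (g₂ , h₂) rewrite eqB-sym g₁ g₂ | eqB-sym h₁ h₂
  | Graph.sym H h₁ h₂ | Graph.sym G g₁ g₂ = refl

pairAdj-irr : (G H : Graph) → ∀ p → pairAdj G H p p ≡ false
pairAdj-irr G H (g , h) rewrite eqB-refl g | eqB-refl h | irrefl H h | irrefl G g = refl

_□_ : Graph → Graph → Graph
G □ H = record
  { order = order G * order H
  ; adj = λ x y → pairAdj G H (remQuot (order H) x) (remQuot (order H) y)
  ; sym = λ x y → pairAdj-sym G H (remQuot (order H) x) (remQuot (order H) y)
  ; irrefl = λ x → pairAdj-irr G H (remQuot (order H) x)
  }

{-# OPTIONS --safe #-}
-- Throughout m ≥ 2 and n is the order of H.  A single layer of K_m □ H is a minimal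
-- dominating set, so if K_m □ H is well-dominated then every dominating set has at least
-- n vertices, and at most n vertices of it can have private neighbours.
--
-- Let S be a set of vertices of H with closed neighbourhood C.  Taking all m fibre vertices
-- above S (or all but those in layer zero) together with the vertices in layer zero outside C
-- yields sets whose size differs from n by m|S| - |C| (or (m-1)|S| - |C|).  For S = {x} this
-- gives m-1 ≤ |N[x]| ≤ m, with |N[x]| = m exactly if N[y] ⊆ N[x] for some neighbour y of x.
-- For S the two ends of an edge xy it shows that N[x] and N[y] are nested.  A vertex s with
-- |N[s]| = m is therefore adjacent to everything, so n = m and every vertex has at most one
-- non-neighbour.  If a and b are not adjacent, then all other vertices are universal, and a
-- vertex x other than s, a, b gives the set {1,…,m-1} × {x} ∪ {0} × {a,b}, a dominating set
-- of size m+1 in which every vertex has a private neighbour; hence H = K_m or H = P₃ and m = 3.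
--
-- Conversely, a dominating set either meets all fibres, or misses the fibre of some h and then
-- meets every layer above a neighbour of h; in each of the listed cases n = m and it contains a
-- dominating set of size m with one vertex per fibre or one vertex per layer.
module Submission where

open import Defs
open import Data.Bool using (Bool; true; false; T; not; _∧_; if_then_else_)
open import Data.Bool.Properties using (T-∧; T-∨; T?)
open import Data.Empty using (⊥; ⊥-elim)
open import Data.Fin using (Fin; zero; suc; combine; remQuot; _≟_; _↑ˡ_; _↑ʳ_)
open import Data.Fin.Permutation using (↔⇒≡)
open import Data.Fin.Properties using (any?; all?; ¬∀⟶∃¬; combine-injective; combine-surjective; remQuot-combine; suc-injective)
open import Data.Fin.Subset using (Subset; _∈_; _⊆_; ∣_∣; ⊤)
open import Data.Fin.Subset.Induction using (⊂-wellFounded)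
open import Data.Fin.Subset.Properties using (anySubset?; _∈?_; _⊆?_; _⊂?_; ∈⊤; ∣p∣≤n; p⊆q⇒∣p∣≤∣q∣)
open import Data.Nat using (ℕ; zero; suc; _+_; _*_; _∸_; _≤_; z≤n; s≤s; _<?_)
open import Data.Nat.Induction using (<-wellFounded)
open import Data.Nat.Properties hiding (_≟_; suc-injective)
import Data.Nat.Properties as ℕ
open import Data.Nat.Solver using (module +-*-Solver)
open import Data.Product using (∃; ∃₂; _×_; _,_; proj₁; proj₂; uncurry)
open import Data.Sum using (_⊎_; inj₁; inj₂; [_,_]′)
open import Data.Unit using (tt)
open import Data.Vec using (tabulate; lookup)
open import Data.Vec.Properties using (lookup∘tabulate; lookup⇒[]=; []=⇒lookup)
open import Function using (_∘_; id)
open import Function.Bundles using (_⇔_; Equivalence; Inverse; mk⇔; mk↔ₛ′)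
open import Function.Construct.Identity using (↔-id)
open import Induction.WellFounded using (WellFounded; Acc; acc)
open import Relation.Binary.Construct.On as On using ()
open import Relation.Binary.PropositionalEquality using (_≡_; _≢_; refl; trans; cong; cong₂; subst) renaming (sym to ≡-sym)
open import Relation.Nullary using (¬_; Dec; yes; no; does)
open import Relation.Nullary.Decidable using (⌊_⌋; _×-dec_; _⊎-dec_; _→-dec_; ¬?; toWitness; fromWitness; fromWitnessFalse; decidable-stable; dec-true; dec-false)
open import Relation.Unary using (Decidable; U; ∅)
open import Relation.Unary.Properties using (U?; ∅?)
open import Algebra.Properties.CommutativeMonoid.Sum +-0-commutativeMonoid using (sum; sum-cong-≗; ∑-distrib-+; ∑-comm)

-- Counting

ind : Bool → ℕ
ind b = if b then 1 else 0

count : ∀ {n} {P : Fin n → Set} → Decidable P → ℕ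
count P? = sum (λ i → ind (does (P? i)))

sum-mono : ∀ {n} {f g : Fin n → ℕ} → (∀ i → f i ≤ g i) → sum f ≤ sum g
sum-mono {zero}  f≤g = z≤n
sum-mono {suc n} f≤g = +-mono-≤ (f≤g zero) (sum-mono (f≤g ∘ suc))

sum-const : ∀ n c → sum {n} (λ _ → c) ≡ n * c
sum-const zero    c = refl
sum-const (suc n) c = cong (c +_) (sum-const n c)

sum-+ : ∀ m {n} (f : Fin (m + n) → ℕ) → sum f ≡ sum (f ∘ (_↑ˡ n)) + sum (f ∘ (m ↑ʳ_))
sum-+ zero    f = refl
sum-+ (suc m) f = trans (cong (f zero +_) (sum-+ m (f ∘ suc))) (≡-sym (+-assoc (f zero) _ _))

sum-* : ∀ m {n} (f : Fin (m * n) → ℕ) → sum f ≡ sum (λ i → sum (λ j → f (combine {m} i j)))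
sum-* zero    f = refl
sum-* (suc m) {n} f = trans (sum-+ n f) (cong (sum (f ∘ (_↑ˡ (m * n))) +_) (sum-* m (f ∘ (n ↑ʳ_))))

module _ {n : ℕ} {P Q : Fin n → Set} (P? : Decidable P) (Q? : Decidable Q) where

  count-mono : (∀ i → P i → Q i) → count P? ≤ count Q?
  count-mono P⊆Q = sum-mono pointwise
    where
    pointwise : ∀ i → ind (does (P? i)) ≤ ind (does (Q? i))
    pointwise i with P? i | Q? i
    ... | no  _ | _     = z≤n
    ... | yes _ | yes _ = ≤-refl
    ... | yes p | no ¬q = ⊥-elim (¬q (P⊆Q i p))

  count-∪-∩ : count (λ i → P? i ⊎-dec Q? i) + count (λ i → P? i ×-dec Q? i) ≡ count P? + count Q?
  count-∪-∩ = trans (≡-sym (∑-distrib-+ (λ i → ind (does (P? i ⊎-dec Q? i))) (λ i → ind (does (P? i ×-dec Q? i)))))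
    (trans (sum-cong-≗ pointwise) (∑-distrib-+ (λ i → ind (does (P? i))) (λ i → ind (does (Q? i)))))
    where
    pointwise : ∀ i → ind (does (P? i ⊎-dec Q? i)) + ind (does (P? i ×-dec Q? i)) ≡ ind (does (P? i)) + ind (does (Q? i))
    pointwise i with does (P? i) | does (Q? i)
    ... | true  | true  = refl
    ... | true  | false = refl
    ... | false | true  = refl
    ... | false | false = refl

  count-∪-≤ : count (λ i → P? i ⊎-dec Q? i) ≤ count P? + count Q?
  count-∪-≤ = ≤-trans (m≤m+n _ _) (≤-reflexive count-∪-∩)

count-cong : ∀ {n} {P Q : Fin n → Set} (P? : Decidable P) (Q? : Decidable Q) →
  (∀ i → P i → Q i) → (∀ i → Q i → P i) → count P? ≡ count Q?
count-cong P? Q? P⊆Q Q⊆P = ≤-antisym (count-mono P? Q? P⊆Q) (count-mono Q? P? Q⊆P)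

count-none : ∀ {n} {P : Fin n → Set} (P? : Decidable P) → (∀ i → ¬ P i) → count P? ≡ 0
count-none {n} P? ¬P = trans (sum-cong-≗ (λ i → cong ind (dec-false (P? i) (¬P i)))) (trans (sum-const n 0) (*-zeroʳ n))

count-all : ∀ {n} {P : Fin n → Set} (P? : Decidable P) → (∀ i → P i) → count P? ≡ n
count-all {n} P? allP = trans (sum-cong-≗ (λ i → cong ind (dec-true (P? i) (allP i)))) (trans (sum-const n 1) (*-identityʳ n))

count-complement : ∀ {n} {P : Fin n → Set} (P? : Decidable P) → count P? + count (¬? ∘ P?) ≡ n
count-complement {n} P? = trans (≡-sym (∑-distrib-+ (λ i → ind (does (P? i))) (λ i → ind (does (¬? (P? i))))))
  (trans (sum-cong-≗ pointwise) (trans (sum-const n 1) (*-identityʳ n)))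
  where
  pointwise : ∀ i → ind (does (P? i)) + ind (does (¬? (P? i))) ≡ 1
  pointwise i with does (P? i)
  ... | true  = refl
  ... | false = refl

count-singleton : ∀ {n} (x : Fin n) → count (_≟ x) ≡ 1
count-singleton {suc n} zero    = cong suc (count-none {n} {λ i → suc i ≡ zero} (λ i → suc i ≟ zero) (λ _ ()))
count-singleton {suc n} (suc x) = trans (count-cong (λ i → suc i ≟ suc x) (_≟ x) (λ _ → suc-injective) (λ _ → cong suc)) (count-singleton x)

count-insert : ∀ {n} {P Q : Fin n → Set} (P? : Decidable P) (Q? : Decidable Q) {x : Fin n} →
  (∀ i → P i → Q i) → ¬ P x → Q x → suc (count P?) ≤ count Q?
count-insert P? Q? {x} P⊆Q ¬Px Qx = begin
  1 + count P?                                                     ≡⟨ cong (_+ count P?) (count-singleton x) ⟨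
  count (_≟ x) + count P?                                          ≡⟨ count-∪-∩ (_≟ x) P? ⟨
  count (λ i → i ≟ x ⊎-dec P? i) + count (λ i → i ≟ x ×-dec P? i)  ≡⟨ cong (count (λ i → i ≟ x ⊎-dec P? i) +_) (count-none (λ i → i ≟ x ×-dec P? i) (λ { _ (refl , p) → ¬Px p })) ⟩
  count (λ i → i ≟ x ⊎-dec P? i) + 0                               ≡⟨ +-identityʳ _ ⟩
  count (λ i → i ≟ x ⊎-dec P? i)                                   ≤⟨ count-mono (λ i → i ≟ x ⊎-dec P? i) Q? (λ { _ (inj₁ refl) → Qx ; i (inj₂ p) → P⊆Q i p }) ⟩
  count Q?                                                         ∎
  where open ≤-Reasoning

count-pair : ∀ {n} {x y : Fin n} → x ≢ y → count (λ i → i ≟ x ⊎-dec i ≟ y) ≡ 2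
count-pair {n} {x} {y} x≢y = ≤-antisym
  (≤-trans (count-∪-≤ (_≟ x) (_≟ y)) (≤-reflexive (cong₂ _+_ (count-singleton x) (count-singleton y))))
  (subst (λ k → suc k ≤ count (λ i → i ≟ x ⊎-dec i ≟ y)) (count-singleton x)
    (count-insert (_≟ x) (λ i → i ≟ x ⊎-dec i ≟ y) (λ _ → inj₁) (x≢y ∘ ≡-sym) (inj₂ refl)))

select : ∀ {m n} {P : Fin m → Fin n → Set} → (∀ g h → Dec (P g h)) → Subset (m * n)
select {m} {n} P? = tabulate (λ z → does (uncurry P? (remQuot {m} n z)))

∣tabulate∣ : ∀ {n} (f : Fin n → Bool) → ∣ tabulate f ∣ ≡ sum (ind ∘ f)
∣tabulate∣ {zero}  f = refl
∣tabulate∣ {suc n} f with f zero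
... | true  = cong suc (∣tabulate∣ (f ∘ suc))
... | false = ∣tabulate∣ (f ∘ suc)

module _ {m n : ℕ} {P : Fin m → Fin n → Set} (P? : ∀ g h → Dec (P g h)) where

  private
    lookup-select : ∀ g h → lookup (select P?) (combine g h) ≡ does (P? g h)
    lookup-select g h = trans (lookup∘tabulate _ (combine g h)) (cong (does ∘ uncurry P?) (remQuot-combine g h))

  ∈-select⁺ : ∀ {g h} → P g h → combine g h ∈ select P?
  ∈-select⁺ {g} {h} p = lookup⇒[]= (combine g h) _ (trans (lookup-select g h) (dec-true (P? g h) p))

  ∈-select⁻ : ∀ {g h} → combine g h ∈ select P? → P g h
  ∈-select⁻ {g} {h} v∈ with P? g h | trans (≡-sym (lookup-select g h)) ([]=⇒lookup v∈)
  ... | yes p | _ = p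

  ∣select∣ : ∣ select P? ∣ ≡ sum (λ g → count (P? g))
  ∣select∣ = trans (∣tabulate∣ f) (trans (sum-* m (ind ∘ f))
    (sum-cong-≗ (λ g → sum-cong-≗ (λ h → cong (ind ∘ does ∘ uncurry P?) (remQuot-combine {m} {n} g h)))))
    where
    f : Fin (m * n) → Bool
    f z = does (uncurry P? (remQuot {m} n z))

  select⊆ : {D : Subset (m * n)} → (∀ {g h} → P g h → combine g h ∈ D) → select P? ⊆ D
  select⊆ P⊆D {v} v∈ with combine-surjective {m} {n} v
  ... | g , h , refl = P⊆D (∈-select⁻ v∈)

-- Private neighbours and domination numbers

-- Decidability of a smaller witness takes the place of excluded middle.
minimal-element : {A : Set} {_≺_ : A → A → Set} → WellFounded _≺_ →
  {P : A → Set} → (∀ x → Dec (∃ λ y → P y × y ≺ x)) →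
  ∀ {x} → P x → ∃ λ y → P y × (∀ z → P z → ¬ (z ≺ y))
minimal-element {A} {_≺_} wf {P} below? {x} = descend (wf x)
  where
  descend : ∀ {x} → Acc _≺_ x → P x → ∃ λ y → P y × (∀ z → P z → ¬ (z ≺ y))
  descend {x} (acc rs) Px with below? x
  ... | yes (y , Py , y≺x) = descend (rs y≺x) Py
  ... | no  none           = x , Px , λ z Pz z≺x → none (z , Pz , z≺x)

Closed : (X : Graph) → Fin (order X) → Fin (order X) → Set
Closed X u v = u ≡ v ⊎ Adj X u v

-- That w lies in the closed neighbourhood of v is automatic when D is dominating.
HasPrivate : (X : Graph) → Subset (order X) → Fin (order X) → Set
HasPrivate X D v = ∃ λ w → ∀ u → u ∈ D → Closed X u w → u ≡ v

Adj? : (X : Graph) → ∀ u v → Dec (Adj X u v)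
Adj? X u v = T? (adj X u v)

Closed? : (X : Graph) → ∀ u v → Dec (Closed X u v)
Closed? X u v = u ≟ v ⊎-dec Adj? X u v

Adj-sym : (X : Graph) → ∀ {u v} → Adj X u v → Adj X v u
Adj-sym X {u} {v} = subst T (sym X u v)

Adj-irrefl : (X : Graph) → ∀ {v} → ¬ Adj X v v
Adj-irrefl X {v} = subst T (irrefl X v)

Adj⇒≢ : (X : Graph) → ∀ {u v} → Adj X u v → u ≢ v
Adj⇒≢ X a refl = Adj-irrefl X a

module _ (X : Graph) where

  dominating⁺ : ∀ {D} → (∀ v → ∃ λ u → u ∈ D × Closed X u v) → Dominating X D
  dominating⁺ dom v with dom v
  ... | u , u∈D , inj₁ refl = inj₁ u∈D
  ... | u , u∈D , inj₂ u~v  = inj₂ (u , u∈D , u~v)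

  dominating⁻ : ∀ {D} → Dominating X D → ∀ v → ∃ λ u → u ∈ D × Closed X u v
  dominating⁻ dom v with dom v
  ... | inj₁ v∈D             = v , v∈D , inj₁ refl
  ... | inj₂ (u , u∈D , u~v) = u , u∈D , inj₂ u~v

  dominating? : Decidable (Dominating X)
  dominating? D = all? (λ v → v ∈? D ⊎-dec any? (λ u → u ∈? D ×-dec Adj? X u v))

  minimalDominating? : Decidable (MinimalDominating X)
  minimalDominating? D with dominating? D | anySubset? (λ E → E ⊂? D ×-dec dominating? E)
  ... | no ¬dom | _                    = no (¬dom ∘ proj₁)
  ... | yes _   | yes (E , E⊂D , domE) = no (λ min → proj₂ min E E⊂D domE)
  ... | yes dom | no none              = yes (dom , λ E E⊂D domE → none (E , E⊂D , domE))

  -- The descent stays among subsets of `D`. Its end is minimal among all dominating sets, since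
  -- anything strictly below it again lies inside `D`.
  minimal-below : ∀ {D} → Dominating X D → ∃ λ E → E ⊆ D × MinimalDominating X E
  minimal-below {D} dom with minimal-element ⊂-wellFounded
    {λ E → Dominating X E × E ⊆ D}
    (λ E → anySubset? (λ F → (dominating? F ×-dec F ⊆? D) ×-dec F ⊂? E)) (dom , id)
  ... | E , (domE , E⊆D) , min = E , E⊆D , domE , λ F F⊂E domF →
    min F (domF , λ x∈F → E⊆D (proj₁ F⊂E x∈F)) F⊂E

  ⊤-dominating : Dominating X ⊤
  ⊤-dominating v = inj₁ ∈⊤

  -- `WellDominated` speaks of whatever numbers meet the two specifications, so using it as a
  -- hypothesis requires exhibiting such numbers.
  dominationNumber : ∃ (IsDominationNumber X)
  dominationNumber with minimal-element (On.wellFounded ∣_∣ <-wellFounded) {Dominating X}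
    (λ D → anySubset? (λ E → dominating? E ×-dec ∣ E ∣ <? ∣ D ∣)) ⊤-dominating
  ... | D , dom , min = ∣ D ∣ , (D , dom , refl) , λ E domE → ≮⇒≥ (min E domE)

  upperDominationNumber : ∃ (IsUpperDominationNumber X)
  -- A largest set is a minimal one for the co-size; returning to sizes needs the cap `∣p∣≤n`, as
  -- subtraction is truncated.
  upperDominationNumber with minimal-element (On.wellFounded (λ D → order X ∸ ∣ D ∣) <-wellFounded)
    {MinimalDominating X}
    (λ D → anySubset? (λ E → minimalDominating? E ×-dec order X ∸ ∣ E ∣ <? order X ∸ ∣ D ∣))
    (proj₂ (proj₂ (minimal-below ⊤-dominating)))
  ... | D , dom , max = ∣ D ∣ , (D , dom , refl) , λ E domE →
    ≮⇒≥ (λ D<E → max E domE (∸-monoʳ-< D<E (∣p∣≤n E)))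

  -- A minimal dominating subset of D still contains every vertex having a private neighbour.
  private≤dominating : WellDominated X → ∀ {I D E} → I ⊆ D → Dominating X D →
    (∀ v → v ∈ I → HasPrivate X D v) → Dominating X E → ∣ I ∣ ≤ ∣ E ∣
  private≤dominating wd {I} {D} {E} I⊆D domD priv domE
    with dominationNumber | upperDominationNumber | minimal-below domD
  ... | γ , isγ | Γ , isΓ | M , M⊆D , minM = begin
    ∣ I ∣  ≤⟨ p⊆q⇒∣p∣≤∣q∣ I⊆M ⟩
    ∣ M ∣  ≤⟨ proj₂ isΓ M minM ⟩
    Γ      ≡⟨ wd γ Γ isγ isΓ ⟨
    γ      ≤⟨ proj₂ isγ E domE ⟩
    ∣ E ∣  ∎
    where
    open ≤-Reasoning
    I⊆M : I ⊆ M
    I⊆M {v} v∈I with priv v v∈I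
    ... | w , only with dominating⁻ (proj₁ minM) w
    ...   | u , u∈M , u~w = subst (_∈ M) (only u (M⊆D u∈M) u~w) u∈M

  -- A dominating set of size `k` inside a minimal dominating set must be all of it, and `lower`
  -- makes `k` the least possible size.
  wellDominated⁺ : ∀ k → (∀ D → Dominating X D → k ≤ ∣ D ∣) →
    (∀ D → MinimalDominating X D → ∃ λ E → E ⊆ D × Dominating X E × ∣ E ∣ ≡ k) → WellDominated X
  wellDominated⁺ k lower upper γ Γ ((D₁ , dom₁ , refl) , γ≤) ((D₂ , min₂ , refl) , _) with upper D₂ min₂
  ... | E , E⊆D₂ , domE , refl = ≤-antisym (γ≤ D₂ (proj₁ min₂)) (≤-trans (p⊆q⇒∣p∣≤∣q∣ D₂⊆E) (lower D₁ dom₁))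
    where
    D₂⊆E : D₂ ⊆ E
    D₂⊆E {v} v∈D₂ = decidable-stable (v ∈? E) λ v∉E → proj₂ min₂ E (E⊆D₂ , v , v∈D₂ , v∉E) domE

-- Domination in K_m □ H

-- Closed adjacency in coordinates. Fibres over vertices of `H` are cliques, so `fibre` puts no
-- condition on `g` and `g′` and also covers equality.
data Closed□ {m : ℕ} (H : Graph) : Fin m → Fin (order H) → Fin m → Fin (order H) → Set where
  fibre : ∀ {g g′ h} → Closed□ H g h g′ h
  layer : ∀ {g h h′} → Adj H h h′ → Closed□ H g h g h′

module _ {m : ℕ} (H : Graph) where

  private
    X : Graph
    X = K m □ H

    pairAdj⁻ : ∀ g h g′ h′ → T (pairAdj (K m) H (g , h) (g′ , h′)) → Closed□ H g h g′ h′
    pairAdj⁻ g h g′ h′ t with Equivalence.to T-∨ t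
    ... | inj₁ t₁ with Equivalence.to (T-∧ {⌊ g ≟ g′ ⌋}) t₁
    ...   | g≡g′ , h~h′ with toWitness {a? = g ≟ g′} g≡g′
    ...     | refl = layer h~h′
    pairAdj⁻ g h g′ h′ t | inj₂ t₂ with toWitness {a? = h ≟ h′} (proj₁ (Equivalence.to (T-∧ {⌊ h ≟ h′ ⌋}) t₂))
    ...     | refl = fibre

    pairAdj-layer : ∀ g {h h′} → Adj H h h′ → T (pairAdj (K m) H (g , h) (g , h′))
    pairAdj-layer g {h} {h′} h~h′ = Equivalence.from T-∨ (inj₁ (Equivalence.from (T-∧ {⌊ g ≟ g ⌋}) (fromWitness {a? = g ≟ g} refl , h~h′)))

    pairAdj-fibre : ∀ {g g′} h → g ≢ g′ → T (pairAdj (K m) H (g , h) (g′ , h))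
    pairAdj-fibre {g} {g′} h g≢g′ = Equivalence.from (T-∨ {⌊ g ≟ g′ ⌋ ∧ adj H h h}) (inj₂ (Equivalence.from (T-∧ {⌊ h ≟ h ⌋})
      (fromWitness {a? = h ≟ h} refl , fromWitnessFalse {a? = g ≟ g′} g≢g′)))

  combine-adj : ∀ g h g′ h′ → adj X (combine g h) (combine g′ h′) ≡ pairAdj (K m) H (g , h) (g′ , h′)
  combine-adj g h g′ h′ = cong₂ (pairAdj (K m) H) (remQuot-combine g h) (remQuot-combine g′ h′)

  closed□⁻ : ∀ {g g′ : Fin m} {h h′} → Closed X (combine g h) (combine g′ h′) → Closed□ H g h g′ h′
  closed□⁻ {g} {g′} {h} {h′} (inj₁ eq) with combine-injective g h g′ h′ eq
  ... | refl , refl = fibre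
  closed□⁻ {g} {g′} {h} {h′} (inj₂ a) = pairAdj⁻ g h g′ h′ (subst T (combine-adj g h g′ h′) a)

  closed□⁺ : ∀ {g g′ : Fin m} {h h′} → Closed□ H g h g′ h′ → Closed X (combine g h) (combine g′ h′)
  closed□⁺ {g} {g′} {h} fibre with g ≟ g′
  ... | yes refl = inj₁ refl
  ... | no  g≢g′ = inj₂ (subst T (≡-sym (combine-adj g h g′ h)) (pairAdj-fibre h g≢g′))
  closed□⁺ {g} {_} {h} {h′} (layer h~h′) = inj₂ (subst T (≡-sym (combine-adj g h g h′)) (pairAdj-layer g h~h′))

  dominating□⁻ : ∀ {D} → Dominating X D → ∀ g h → ∃₂ λ g′ h′ → combine g′ h′ ∈ D × Closed□ H g′ h′ g h
  dominating□⁻ dom g h with dominating⁻ X dom (combine g h)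
  ... | u , u∈D , c with combine-surjective {m} {order H} u
  ...   | g′ , h′ , refl = g′ , h′ , u∈D , closed□⁻ c

  module _ {P : Fin m → Fin (order H) → Set} (P? : ∀ g h → Dec (P g h)) where

    select-dominating : (∀ g h → ∃₂ λ g′ h′ → P g′ h′ × Closed□ H g′ h′ g h) → Dominating X (select P?)
    select-dominating dom = dominating⁺ X λ v → dominated v (combine-surjective {m} {order H} v)
      where
      dominated : ∀ v → (∃₂ λ g h → combine g h ≡ v) → ∃ λ u → u ∈ select P? × Closed X u v
      dominated _ (g , h , refl) with dom g h
      ... | g′ , h′ , p , c = combine g′ h′ , ∈-select⁺ P? p , closed□⁺ c

    select-private : ∀ {g h} → (∃₂ λ g′ h′ → ∀ g″ h″ → P g″ h″ → Closed□ H g″ h″ g′ h′ → g″ ≡ g × h″ ≡ h) →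
      HasPrivate X (select P?) (combine g h)
    select-private {g} {h} (g′ , h′ , only) = combine g′ h′ , λ u → unique u (combine-surjective {m} {order H} u)
      where
      unique : ∀ u → (∃₂ λ g″ h″ → combine g″ h″ ≡ u) → u ∈ select P? → Closed X u (combine g′ h′) → u ≡ combine g h
      unique _ (g″ , h″ , refl) u∈ c with only g″ h″ (∈-select⁻ P? u∈) (closed□⁻ c)
      ... | refl , refl = refl

-- The graphs K_n and P₃

record Path₃ (H : Graph) : Set where
  field
    centre left right : Fin (order H)
    centre~left       : Adj H centre left
    centre~right      : Adj H centre right
    left≁right        : ¬ Adj H left right
    left≢right        : left ≢ right
    exhaust           : ∀ h → h ≡ centre ⊎ (h ≡ left ⊎ h ≡ right)

T⇒≡true : ∀ {b} → T b → b ≡ true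
T⇒≡true {true} _ = refl

¬T⇒≡false : ∀ {b} → ¬ T b → b ≡ false
¬T⇒≡false {true}  ¬t = ⊥-elim (¬t tt)
¬T⇒≡false {false} _  = refl

path₃⇒≅P₃ : (H : Graph) → Path₃ H → H ≅ P₃
path₃⇒≅P₃ H path = record
  { bij  = mk↔ₛ′ position vertex position-vertex vertex-position
  ; pres = λ u v → trans (adj-vertex (position u) (position v)) (cong₂ (adj H) (vertex-position u) (vertex-position v))
  }
  where
  open Path₃ path

  vertex : Fin 3 → Fin (order H)
  vertex zero             = left
  vertex (suc zero)       = centre
  vertex (suc (suc zero)) = right

  position : Fin (order H) → Fin 3
  position h with exhaust h
  ... | inj₁ _        = suc zero
  ... | inj₂ (inj₁ _) = zero
  ... | inj₂ (inj₂ _) = suc (suc zero)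

  vertex-position : ∀ h → vertex (position h) ≡ h
  vertex-position h with exhaust h
  ... | inj₁ h≡s        = ≡-sym h≡s
  ... | inj₂ (inj₁ h≡a) = ≡-sym h≡a
  ... | inj₂ (inj₂ h≡b) = ≡-sym h≡b

  vertex-injective : ∀ i j → vertex i ≡ vertex j → i ≡ j
  vertex-injective zero             zero             _  = refl
  vertex-injective zero             (suc zero)       eq = ⊥-elim (Adj⇒≢ H centre~left (≡-sym eq))
  vertex-injective zero             (suc (suc zero)) eq = ⊥-elim (left≢right eq)
  vertex-injective (suc zero)       zero             eq = ⊥-elim (Adj⇒≢ H centre~left eq)
  vertex-injective (suc zero)       (suc zero)       _  = refl
  vertex-injective (suc zero)       (suc (suc zero)) eq = ⊥-elim (Adj⇒≢ H centre~right eq)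
  vertex-injective (suc (suc zero)) zero             eq = ⊥-elim (left≢right (≡-sym eq))
  vertex-injective (suc (suc zero)) (suc zero)       eq = ⊥-elim (Adj⇒≢ H centre~right (≡-sym eq))
  vertex-injective (suc (suc zero)) (suc (suc zero)) _  = refl

  position-vertex : ∀ i → position (vertex i) ≡ i
  position-vertex i = vertex-injective (position (vertex i)) i (vertex-position (vertex i))

  adj-vertex : ∀ i j → p3adj i j ≡ adj H (vertex i) (vertex j)
  adj-vertex zero             zero             = ≡-sym (irrefl H left)
  adj-vertex zero             (suc zero)       = ≡-sym (T⇒≡true (Adj-sym H centre~left))
  adj-vertex zero             (suc (suc zero)) = ≡-sym (¬T⇒≡false left≁right)
  adj-vertex (suc zero)       zero             = ≡-sym (T⇒≡true centre~left)
  adj-vertex (suc zero)       (suc zero)       = ≡-sym (irrefl H centre)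
  adj-vertex (suc zero)       (suc (suc zero)) = ≡-sym (T⇒≡true centre~right)
  adj-vertex (suc (suc zero)) zero             = ≡-sym (¬T⇒≡false (left≁right ∘ Adj-sym H))
  adj-vertex (suc (suc zero)) (suc zero)       = ≡-sym (T⇒≡true (Adj-sym H centre~right))
  adj-vertex (suc (suc zero)) (suc (suc zero)) = ≡-sym (irrefl H right)

complete⇒≅K : (H : Graph) → (∀ u v → u ≢ v → Adj H u v) → H ≅ K (order H)
complete⇒≅K H complete = record { bij = ↔-id (Fin (order H)) ; pres = same }
  where
  same : ∀ u v → not ⌊ u ≟ v ⌋ ≡ adj H u v
  same u v with u ≟ v
  ... | yes refl = ≡-sym (irrefl H u)
  ... | no u≢v   = ≡-sym (T⇒≡true (complete u v u≢v))

two-elements : ∀ {n} → 2 ≤ n → ∃₂ λ (u v : Fin n) → u ≢ v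
two-elements (s≤s (s≤s _)) = zero , suc zero , λ ()

first-edge : (H : Graph) → ∀ {u v} → u ≢ v → Walk H u v → ∃ (Adj H u)
first-edge H u≢u here         = ⊥-elim (u≢u refl)
first-edge H _   (step u~w _) = _ , u~w

-- Sets with a special layer zero and equal layers above it

TwoLevel : {k n : ℕ} → (A B : Fin n → Set) → Fin (suc k) → Fin n → Set
TwoLevel A B zero    = A
TwoLevel A B (suc _) = B

twoLevel? : {k n : ℕ} {A B : Fin n → Set} → Decidable A → Decidable B → ∀ (g : Fin (suc k)) h → Dec (TwoLevel A B g h)
twoLevel? A? B? zero    = A?
twoLevel? A? B? (suc _) = B?

-- The order `2 + k` encodes `m ≥ 2`: layer one always exists, and `suc k` is `m - 1`.
twoLevel : ∀ k {n} {A B : Fin n → Set} → Decidable A → Decidable B → Subset ((2 + k) * n)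
twoLevel k A? B? = select {2 + k} (twoLevel? A? B?)

∣twoLevel∣ : ∀ k {n} {A B : Fin n → Set} (A? : Decidable A) (B? : Decidable B) →
  ∣ twoLevel k A? B? ∣ ≡ count A? + suc k * count B?
∣twoLevel∣ k A? B? = trans (∣select∣ {2 + k} (twoLevel? A? B?)) (cong (count A? +_) (sum-const (suc k) (count B?)))

module _ (H : Graph) where

  deg⁺ : Fin (order H) → ℕ
  deg⁺ x = count (Closed? H x)

  -- Either one selected vertex above `h` dominates its whole fibre, or each layer needs its own
  -- edge into `h`: layer zero from `A`, the others from `B`.
  TwoLevelDominating : (A B : Fin (order H) → Set) → Set
  TwoLevelDominating A B = ∀ h → (A h ⊎ B h) ⊎ ((∃ λ a → A a × Adj H a h) × (∃ λ b → B b × Adj H b h))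

  -- The private neighbour of `(0, h)` is `(1, h)` for `noB`, the vertex itself for `noA`, and
  -- `(0, w)` for `ext`, where the fibre over `w` is missed.
  data Private₀ (A B : Fin (order H) → Set) (h : Fin (order H)) : Set where
    noB : ¬ B h → (∀ b → B b → ¬ Adj H b h) → Private₀ A B h
    noA : ¬ B h → (∀ a → A a → ¬ Adj H a h) → Private₀ A B h
    ext : ∀ w → ¬ A w → ¬ B w → (∀ a → A a → Adj H a w → a ≡ h) → Private₀ A B h

  Private₊ : (A B : Fin (order H) → Set) → Fin (order H) → Set
  Private₊ A B h = ∃ λ w → ¬ A w × ¬ B w × (∀ b → B b → Adj H b w → b ≡ h)

  module _ {k : ℕ} {A B : Fin (order H) → Set} (A? : Decidable A) (B? : Decidable B) where

    twoLevel-dominating : TwoLevelDominating A B → Dominating (K (2 + k) □ H) (twoLevel k A? B?)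
    twoLevel-dominating dom = select-dominating H (twoLevel? A? B?) dominated
      where
      dominated : ∀ (g : Fin (2 + k)) h → ∃₂ λ g′ h′ → TwoLevel A B g′ h′ × Closed□ H g′ h′ g h
      dominated g h with dom h
      ... | inj₁ (inj₁ a) = zero , h , a , fibre
      ... | inj₁ (inj₂ b) = suc zero , h , b , fibre
      dominated zero    h | inj₂ ((a , Aa , a~h) , _) = zero , a , Aa , layer a~h
      dominated (suc g) h | inj₂ (_ , (b , Bb , b~h)) = suc g , b , Bb , layer b~h

    twoLevel-private₀ : ∀ {h} → Private₀ A B h → HasPrivate (K (2 + k) □ H) (twoLevel k A? B?) (combine {2 + k} zero h)
    twoLevel-private₀ {h} priv = select-private H (twoLevel? A? B?) (witness priv)
      where
      witness : Private₀ A B h → ∃₂ λ g′ h′ → ∀ (g″ : Fin (2 + k)) h″ → TwoLevel A B g″ h″ →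
        Closed□ H g″ h″ g′ h′ → g″ ≡ zero × h″ ≡ h
      witness (noB ¬Bh ¬B~h) = suc zero , h , λ where
        zero    _ _ fibre       → refl , refl
        (suc _) _ b fibre       → ⊥-elim (¬Bh b)
        (suc _) _ b (layer b~h) → ⊥-elim (¬B~h _ b b~h)
      witness (noA ¬Bh ¬A~h) = zero , h , λ where
        zero    _ _ fibre       → refl , refl
        (suc _) _ b fibre       → ⊥-elim (¬Bh b)
        zero    _ a (layer a~h) → ⊥-elim (¬A~h _ a a~h)
      witness (ext w ¬Aw ¬Bw only) = zero , w , λ where
        zero    _ a fibre       → ⊥-elim (¬Aw a)
        (suc _) _ b fibre       → ⊥-elim (¬Bw b)
        zero    _ a (layer a~w) → refl , only _ a a~w

    twoLevel-private₊ : ∀ {i : Fin (suc k)} {h} → Private₊ A B h → HasPrivate (K (2 + k) □ H) (twoLevel k A? B?) (combine {2 + k} (suc i) h)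
    twoLevel-private₊ {i} {h} (w , ¬Aw , ¬Bw , only) = select-private H (twoLevel? A? B?) (suc i , w , λ where
      zero    _ a fibre       → ⊥-elim (¬Aw a)
      (suc _) _ b fibre       → ⊥-elim (¬Bw b)
      (suc _) _ b (layer b~w) → refl , only _ b b~w)

    -- `A′` and `B′` collect members with known private neighbours; only these are sure to survive
    -- in a minimal dominating subset.
    twoLevel-bound : WellDominated (K (2 + k) □ H) → TwoLevelDominating A B →
      {A′ B′ : Fin (order H) → Set} (A′? : Decidable A′) (B′? : Decidable B′) →
      (∀ h → A′ h → A h × Private₀ A B h) → (∀ h → B′ h → B h × Private₊ A B h) →
      ∀ {D} → Dominating (K (2 + k) □ H) D → count A′? + suc k * count B′? ≤ ∣ D ∣
    twoLevel-bound wd dom {A′} {B′} A′? B′? priv₀ priv₊ domD =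
      ≤-trans (≤-reflexive (≡-sym (∣twoLevel∣ k A′? B′?)))
        (private≤dominating (K (2 + k) □ H) wd
          (select⊆ (twoLevel? A′? B′?) (λ {g} {h} p → ∈-select⁺ (twoLevel? A? B?) (included g h p)))
          (twoLevel-dominating dom)
          (λ v → hasPrivate v (combine-surjective {2 + k} {order H} v))
          domD)
      where
      included : ∀ (g : Fin (2 + k)) h → TwoLevel A′ B′ g h → TwoLevel A B g h
      included zero    h = proj₁ ∘ priv₀ h
      included (suc g) h = proj₁ ∘ priv₊ h
      hasPrivate : ∀ v → (∃₂ λ g h → combine {2 + k} g h ≡ v) → v ∈ twoLevel k A′? B′? →
        HasPrivate (K (2 + k) □ H) (twoLevel k A? B?) v
      hasPrivate _ (zero  , h , refl) v∈ = twoLevel-private₀ (proj₂ (priv₀ h (∈-select⁻ {2 + k} (twoLevel? A′? B′?) v∈)))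
      hasPrivate _ (suc i , h , refl) v∈ = twoLevel-private₊ {i} (proj₂ (priv₊ h (∈-select⁻ {2 + k} (twoLevel? A′? B′?) {suc i} v∈)))

-- Necessity

module Forward (k : ℕ) (H : Graph) (wd : WellDominated (K (2 + k) □ H)) where

  private
    n : ℕ
    n = order H

    V : Set
    V = Fin n

    infix 4 _∼_
    _∼_ : V → V → Set
    _∼_ = Adj H

    ∼-sym : ∀ {u v} → u ∼ v → v ∼ u
    ∼-sym = Adj-sym H

    N[_] : V → V → Set
    N[ x ] = Closed H x

    allV? : Decidable {A = V} U
    allV? = U?

    noV? : Decidable {A = V} ∅
    noV? = ∅?

    layer-dominating : TwoLevelDominating H U ∅
    layer-dominating _ = inj₁ (inj₁ tt)

    ∣layer∣ : count allV? + suc k * count noV? ≡ n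
    ∣layer∣ = trans (cong₂ _+_ (count-all allV? (λ _ → tt)) (trans (cong (suc k *_) (count-none noV? (λ _ ()))) (*-zeroʳ (suc k)))) (+-identityʳ n)

  private-bound : {A B : V → Set} (A? : Decidable A) (B? : Decidable B) → TwoLevelDominating H A B →
    {A′ B′ : V → Set} (A′? : Decidable A′) (B′? : Decidable B′) →
    (∀ h → A′ h → A h × Private₀ H A B h) → (∀ h → B′ h → B h × Private₊ H A B h) →
    count A′? + suc k * count B′? ≤ n
  private-bound A? B? dom A′? B′? priv₀ priv₊ =
    ≤-trans (twoLevel-bound H A? B? wd dom A′? B′? priv₀ priv₊ (twoLevel-dominating H allV? noV? layer-dominating))
      (≤-reflexive (trans (∣twoLevel∣ k allV? noV?) ∣layer∣))

  -- When layer zero is the dominating set, `(1, h)` is a private neighbour of `(0, h)`, so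
  -- well-domination makes `n` a lower bound.
  dominating-bound : {A B : V → Set} (A? : Decidable A) (B? : Decidable B) → TwoLevelDominating H A B →
    n ≤ count A? + suc k * count B?
  dominating-bound A? B? dom = subst (_≤ count A? + suc k * count B?) ∣layer∣
    (≤-trans (twoLevel-bound H allV? noV? wd layer-dominating allV? noV?
        (λ _ _ → tt , noB (λ ()) (λ _ ())) (λ _ ()) (twoLevel-dominating H A? B? dom))
      (≤-reflexive (∣twoLevel∣ k A? B?)))

  -- Full fibres over a vertex set

  module Core {S : V → Set} (S? : Decidable S) where

    C : V → Set
    C h = ∃ λ x → S x × N[ x ] h

    C? : Decidable C
    C? h = any? (λ x → S? x ×-dec Closed? H x h)

    private
      A : V → Set
      A h = S h ⊎ ¬ C h

      A? : Decidable A
      A? h = S? h ⊎-dec ¬? (C? h)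

      ∣C∣ ∣∁C∣ ∣S∣ : ℕ
      ∣C∣ = count C?
      ∣∁C∣ = count (¬? ∘ C?)
      ∣S∣ = count S?

      S⊆C : ∀ {h} → S h → C h
      S⊆C Sh = _ , Sh , inj₁ refl

      ∣A∣ : count A? ≡ ∣S∣ + ∣∁C∣
      ∣A∣ = trans (≡-sym (+-identityʳ _)) (trans (cong (count A? +_) (≡-sym disjoint)) (count-∪-∩ S? (¬? ∘ C?)))
        where
        disjoint : count (λ h → S? h ×-dec ¬? (C? h)) ≡ 0
        disjoint = count-none (λ h → S? h ×-dec ¬? (C? h)) (λ { _ (Sh , ¬Ch) → ¬Ch (S⊆C Sh) })

      full-dominating : TwoLevelDominating H A S
      full-dominating h with C? h
      ... | no ¬Ch                   = inj₁ (inj₁ (inj₂ ¬Ch))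
      ... | yes (_ , Sh , inj₁ refl) = inj₁ (inj₂ Sh)
      ... | yes (x , Sx , inj₂ x~h)  = inj₂ ((x , inj₁ Sx , x~h) , (x , Sx , x~h))

      outside-private : ∀ h → ¬ C h → A h × Private₀ H A S h
      outside-private h ¬Ch = inj₂ ¬Ch , noB (¬Ch ∘ S⊆C) (λ b Sb b~h → ¬Ch (b , Sb , inj₂ b~h))

      cancel-∁C : ∀ {x} → ∣∁C∣ + x ≤ n → x ≤ ∣C∣
      cancel-∁C {x} le = +-cancelˡ-≤ ∣∁C∣ x ∣C∣ (≤-trans le (≤-reflexive (trans (≡-sym (count-complement C?)) (+-comm ∣C∣ ∣∁C∣))))

      cancel-∁C′ : ∀ {x} → n ≤ ∣∁C∣ + x → ∣C∣ ≤ x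
      cancel-∁C′ {x} le = +-cancelˡ-≤ ∣∁C∣ ∣C∣ x (≤-trans (≤-reflexive (trans (+-comm ∣∁C∣ ∣C∣) (count-complement C?))) le)

      rearrange : count A? + suc k * ∣S∣ ≡ ∣∁C∣ + (2 + k) * ∣S∣
      rearrange = trans (cong (_+ suc k * ∣S∣) (trans ∣A∣ (+-comm ∣S∣ ∣∁C∣))) (+-assoc ∣∁C∣ ∣S∣ (suc k * ∣S∣))

    ExternalPrivate : V → V → Set
    ExternalPrivate x y = x ∼ y × ¬ S y × (∀ x′ → S x′ → x′ ∼ y → x′ ≡ x)

    private
      private₊ : ∀ {x y} → S x → ExternalPrivate x y → S x × Private₊ H A S x
      -- `y` lies in `C` but not in `S`, hence not in `A`, and its fibre is missed.
      private₊ {x} {y} Sx (x~y , ¬Sy , only) = Sx , y , [ ¬Sy , (λ ¬Cy → ¬Cy (x , Sx , inj₂ x~y)) ]′ , ¬Sy , only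

    -- Counts the vertices outside `C` in layer zero and the copies of `S` in the other layers. The
    -- copy of `S` in layer zero is left out: there `y` may also be reached from outside `C`.
    externalPrivate-bound : (∀ x → S x → ∃ (ExternalPrivate x)) → suc k * count S? ≤ count C?
    externalPrivate-bound epn = cancel-∁C
      (private-bound A? S? full-dominating (¬? ∘ C?) S? outside-private (λ x Sx → private₊ Sx (proj₂ (epn x Sx))))

    -- Once no neighbour of `y` lies outside `C`, `(0, y)` is private too, and the copy of `S` in
    -- layer zero can be counted.
    enclosedPrivate-bound : (∀ x → S x → ∃ λ y → ExternalPrivate x y × (∀ v → v ∼ y → C v)) →
      (2 + k) * count S? ≤ count C?
    enclosedPrivate-bound epn = cancel-∁C (subst (_≤ n) rearrange
      (private-bound A? S? full-dominating A? S? private₀ (λ x Sx → private₊ Sx (proj₁ (proj₂ (epn x Sx))))))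
      where
      private₀ : ∀ h → A h → A h × Private₀ H A S h
      private₀ h (inj₂ ¬Ch) = outside-private h ¬Ch
      private₀ h (inj₁ Sh) with epn h Sh
      ... | y , ep@(h~y , ¬Sy , only) , N⊆C = inj₁ Sh , ext y (proj₁ (proj₂ (proj₂ (private₊ Sh ep)))) ¬Sy
        (λ { a (inj₁ Sa) a~y → only a Sa a~y ; a (inj₂ ¬Ca) a~y → ⊥-elim (¬Ca (N⊆C a a~y)) })

    -- Full fibres over `S` dominate everything over `C`, so they must make up for the part of layer
    -- zero that they replace.
    neighbourhood-bound : count C? ≤ (2 + k) * count S?
    neighbourhood-bound = cancel-∁C′ (subst (n ≤_) rearrange (dominating-bound A? S? full-dominating))

    -- `S` is dropped from layer zero. Its fibres are still met above, and vertices outside `C`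
    -- dominate layer zero over the rest of `C`, which saves one copy of `S`.
    escaping-bound : (∀ h → C h → ¬ S h → ∃ λ v → v ∼ h × ¬ C v) → count C? ≤ suc k * count S?
    escaping-bound escape = cancel-∁C′ (dominating-bound (¬? ∘ C?) S? dom)
      where
      dom : TwoLevelDominating H (λ h → ¬ C h) S
      dom h with C? h
      ... | no ¬Ch                   = inj₁ (inj₁ ¬Ch)
      ... | yes (_ , Sh , inj₁ refl) = inj₁ (inj₂ Sh)
      ... | yes (x , Sx , inj₂ x~h) with S? h
      ...   | yes Sh = inj₁ (inj₂ Sh)
      ...   | no ¬Sh with escape h (x , Sx , inj₂ x~h) ¬Sh
      ...     | v , v~h , ¬Cv = inj₂ ((v , ¬Cv , v~h) , (x , Sx , x~h))

  split-neighbours : ∀ x → (∃ λ y → x ∼ y × (∀ v → v ∼ y → N[ x ] v)) ⊎ (∀ y → x ∼ y → ∃ λ v → v ∼ y × ¬ N[ x ] v)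
  split-neighbours x with any? (λ y → Adj? H x y ×-dec all? (λ v → Adj? H v y →-dec Closed? H x v))
  ... | yes enclosed = inj₁ enclosed
  ... | no none = inj₂ λ y x~y →
    let v , ¬imp = ¬∀⟶∃¬ n (λ v → v ∼ y → N[ x ] v) (λ v → Adj? H v y →-dec Closed? H x v) (λ enc → none (y , x~y , enc))
    in v , decidable-stable (Adj? H v y) (λ v≁y → ¬imp (⊥-elim ∘ v≁y)) , λ v∈N → ¬imp (λ _ → v∈N)

  -- Closed degrees, from one-vertex sets

  module _ (x : V) where

    private
      open Core (_≟ x)

      ∣C∣≡ : count C? ≡ deg⁺ H x
      ∣C∣≡ = count-cong C? (Closed? H x) (λ { _ (_ , refl , c) → c }) (λ _ c → x , refl , c)

      ∣S∣* : ∀ j → j * count (_≟ x) ≡ j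
      ∣S∣* j = trans (cong (j *_) (count-singleton x)) (*-identityʳ j)

      external : ∀ {y} → x ∼ y → ExternalPrivate x y
      external x~y = x~y , (λ y≡x → Adj⇒≢ H x~y (≡-sym y≡x)) , λ _ x′≡x _ → x′≡x

    deg⁺≤m : deg⁺ H x ≤ 2 + k
    deg⁺≤m = subst (_≤ 2 + k) ∣C∣≡ (subst (count C? ≤_) (∣S∣* (2 + k)) neighbourhood-bound)

    m≤1+deg⁺ : ∀ {y} → x ∼ y → suc k ≤ deg⁺ H x
    m≤1+deg⁺ {y} x~y = subst (suc k ≤_) ∣C∣≡ (subst (_≤ count C?) (∣S∣* (suc k))
      (externalPrivate-bound λ { _ refl → y , external x~y }))

    enclosed⇒m≤deg⁺ : ∀ {y} → x ∼ y → (∀ v → v ∼ y → N[ x ] v) → 2 + k ≤ deg⁺ H x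
    enclosed⇒m≤deg⁺ {y} x~y enc = subst (2 + k ≤_) ∣C∣≡ (subst (_≤ count C?) (∣S∣* (2 + k))
      (enclosedPrivate-bound λ { _ refl → y , external x~y , λ v v~y → x , refl , enc v v~y }))

    -- If every neighbour of `x` had a neighbour outside `N[ x ]`, `escaping-bound` would give
    -- closed degree at most `m - 1`.
    m≤deg⁺⇒enclosed : 2 + k ≤ deg⁺ H x → ∃ λ y → x ∼ y × (∀ v → v ∼ y → N[ x ] v)
    m≤deg⁺⇒enclosed m≤deg with split-neighbours x
    ... | inj₁ enclosed = enclosed
    ... | inj₂ escape   = ⊥-elim (<-irrefl refl (≤-trans m≤deg (subst (_≤ suc k) ∣C∣≡ (subst (count C? ≤_) (∣S∣* (suc k))
      (escaping-bound λ { h (_ , refl , c) h≢x → escapes h c h≢x })))))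
      where
      escapes : ∀ h → N[ x ] h → ¬ (h ≡ x) → ∃ λ v → v ∼ h × ¬ C v
      escapes h (inj₁ x≡h) h≢x = ⊥-elim (h≢x (≡-sym x≡h))
      escapes h (inj₂ x~h) _   = let v , v~h , ¬c = escape h x~h in v , v~h , λ { (_ , refl , c) → ¬c c }

  -- Nested neighbourhoods, from the two ends of an edge

  module Edge {x y : V} (x~y : x ∼ y) where

    private
      S? : Decidable (λ h → h ≡ x ⊎ h ≡ y)
      S? h = h ≟ x ⊎-dec h ≟ y

      open Core S?

      ∪? : Decidable (λ h → N[ x ] h ⊎ N[ y ] h)
      ∪? h = Closed? H x h ⊎-dec Closed? H y h

      ∩? : Decidable (λ h → N[ x ] h × N[ y ] h)
      ∩? h = Closed? H x h ×-dec Closed? H y h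

      ∣C∣≡ : count C? ≡ count ∪?
      ∣C∣≡ = count-cong C? ∪?
        (λ { _ (_ , inj₁ refl , c) → inj₁ c ; _ (_ , inj₂ refl , c) → inj₂ c })
        (λ { _ (inj₁ c) → x , inj₁ refl , c ; _ (inj₂ c) → y , inj₂ refl , c })

      ∣S∣* : ∀ j → j * count S? ≡ j + j
      ∣S∣* j = trans (cong (j *_) (count-pair (Adj⇒≢ H x~y))) (trans (*-comm j 2) (cong (j +_) (+-identityʳ j)))

      S⊆∩ : ∀ h → h ≡ x ⊎ h ≡ y → N[ x ] h × N[ y ] h
      S⊆∩ _ (inj₁ refl) = inj₁ refl , inj₂ (∼-sym x~y)
      S⊆∩ _ (inj₂ refl) = inj₂ x~y , inj₁ refl

      external-x : ∀ {p} → x ∼ p → ¬ N[ y ] p → ExternalPrivate x p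
      external-x x~p y≁p = x~p , [ (λ p≡x → Adj⇒≢ H x~p (≡-sym p≡x)) , (λ p≡y → y≁p (inj₁ (≡-sym p≡y))) ]′ ,
        λ { _ (inj₁ refl) _ → refl ; _ (inj₂ refl) y~p → ⊥-elim (y≁p (inj₂ y~p)) }

      external-y : ∀ {q} → y ∼ q → ¬ N[ x ] q → ExternalPrivate y q
      external-y y~q x≁q = y~q , [ (λ q≡x → x≁q (inj₁ (≡-sym q≡x))) , (λ q≡y → Adj⇒≢ H y~q (≡-sym q≡y)) ]′ ,
        λ { _ (inj₁ refl) x~q → ⊥-elim (x≁q (inj₂ x~q)) ; _ (inj₂ refl) _ → refl }

      2≤∣∩∣ : 2 ≤ count ∩?
      2≤∣∩∣ = subst (_≤ count ∩?) (count-pair (Adj⇒≢ H x~y)) (count-mono S? ∩? S⊆∩)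

      ∣∪∣+∣∩∣≤ : count ∪? + count ∩? ≤ (2 + k) + (2 + k)
      ∣∪∣+∣∩∣≤ = ≤-trans (≤-reflexive (count-∪-∩ (Closed? H x) (Closed? H y))) (+-mono-≤ (deg⁺≤m x) (deg⁺≤m y))

      twice : ∀ j → suc k + suc k + (2 + j) ≡ (2 + k) + (2 + k) + j
      twice j = solve 2 (λ k j → con 1 :+ k :+ (con 1 :+ k) :+ (con 2 :+ j) := con 2 :+ k :+ (con 2 :+ k) :+ j) refl k j
        where open +-*-Solver

    module _ {p q : V} (x~p : x ∼ p) (y≁p : ¬ N[ y ] p) (y~q : y ∼ q) (x≁q : ¬ N[ x ] q) where

      private
        2m-2≤∣∪∣ : suc k + suc k ≤ count ∪?
        2m-2≤∣∪∣ = subst (suc k + suc k ≤_) ∣C∣≡ (subst (_≤ count C?) (∣S∣* (suc k)) (externalPrivate-bound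
          λ { _ (inj₁ refl) → p , external-x x~p y≁p ; _ (inj₂ refl) → q , external-y y~q x≁q }))

      -- The union has at least `2m - 2` elements and the intersection contains `x` and `y`, so the
      -- closed degrees sum to at least `2m`; the one at `y` is at most `m`.
      m≤deg⁺ : 2 + k ≤ deg⁺ H x
      m≤deg⁺ = +-cancelʳ-≤ (2 + k) (2 + k) (deg⁺ H x) (begin
        2 + k + (2 + k)          ≡⟨ trans (twice 0) (+-identityʳ _) ⟨
        suc k + suc k + 2        ≤⟨ +-mono-≤ 2m-2≤∣∪∣ 2≤∣∩∣ ⟩
        count ∪? + count ∩?      ≡⟨ count-∪-∩ (Closed? H x) (Closed? H y) ⟩
        deg⁺ H x + deg⁺ H y      ≤⟨ +-monoʳ-≤ (deg⁺ H x) (deg⁺≤m y) ⟩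
        deg⁺ H x + (2 + k)       ∎)
        where open ≤-Reasoning

      -- A third common element would push the sum of the closed degrees to `2m + 1`, while each is
      -- at most `m`.
      no-common-neighbour : ∀ {v} → x ∼ v → ¬ y ∼ v
      no-common-neighbour {v} x~v y~v = n≮n (2 + k + (2 + k)) (begin-strict
        2 + k + (2 + k)          <⟨ m<m+n (2 + k + (2 + k)) {1} (s≤s z≤n) ⟩
        2 + k + (2 + k) + 1      ≡⟨ twice 1 ⟨
        suc k + suc k + 3        ≤⟨ +-mono-≤ 2m-2≤∣∪∣ 3≤∣∩∣ ⟩
        count ∪? + count ∩?      ≤⟨ ∣∪∣+∣∩∣≤ ⟩
        2 + k + (2 + k)          ∎)
        where
        open ≤-Reasoning
        3≤∣∩∣ : 3 ≤ count ∩?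
        3≤∣∩∣ = subst (λ j → suc j ≤ count ∩?) (count-pair (Adj⇒≢ H x~y)) (count-insert S? ∩? S⊆∩
          [ (λ v≡x → Adj⇒≢ H x~v (≡-sym v≡x)) , (λ v≡y → Adj⇒≢ H y~v (≡-sym v≡y)) ]′ (inj₂ x~v , inj₂ y~v))

      enclosed-private : ∃ λ w → x ∼ w × ¬ N[ y ] w × (∀ v → v ∼ w → N[ x ] v)
      enclosed-private =
        let w , x~w , enc = m≤deg⁺⇒enclosed x m≤deg⁺
        -- `w` is not `y`, whose neighbour `q` escapes `N[ x ]`, and is not adjacent to `y` for lack
        -- of common neighbours.
        in w , x~w , [ (λ y≡w → x≁q (enc q (subst (q ∼_) y≡w (∼-sym y~q)))) , no-common-neighbour x~w ]′ , enc

    -- With both private neighbours enclosed, the union alone has `2m` elements; the two common ones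
    -- then exceed the bound `2m`.
    not-enclosed : ∀ {p q} → x ∼ p → ¬ N[ y ] p → (∀ v → v ∼ p → N[ x ] v) → y ∼ q → ¬ N[ x ] q → ¬ (∀ v → v ∼ q → N[ y ] v)
    not-enclosed {p} {q} x~p y≁p encp y~q x≁q encq = n≮n (2 + k + (2 + k)) (begin-strict
      2 + k + (2 + k)          <⟨ m<m+n (2 + k + (2 + k)) {2} (s≤s z≤n) ⟩
      2 + k + (2 + k) + 2      ≤⟨ +-mono-≤ 2m≤∣∪∣ 2≤∣∩∣ ⟩
      count ∪? + count ∩?      ≤⟨ ∣∪∣+∣∩∣≤ ⟩
      2 + k + (2 + k)          ∎)
      where
      open ≤-Reasoning
      2m≤∣∪∣ : 2 + k + (2 + k) ≤ count ∪?
      2m≤∣∪∣ = subst (2 + k + (2 + k) ≤_) ∣C∣≡ (subst (_≤ count C?) (∣S∣* (2 + k)) (enclosedPrivate-bound λ where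
        _ (inj₁ refl) → p , external-x x~p y≁p , λ v v~p → x , inj₁ refl , encp v v~p
        _ (inj₂ refl) → q , external-y y~q x≁q , λ v v~q → y , inj₂ refl , encq v v~q))

  -- Both ends have closed degree `m`, so `p` and `q` can be traded for enclosed private neighbours,
  -- which `not-enclosed` rules out.
  no-crossing-edge : ∀ {x y p q} → x ∼ y → x ∼ p → ¬ N[ y ] p → y ∼ q → ¬ N[ x ] q → ⊥
  no-crossing-edge x~y x~p y≁p y~q x≁q =
    let w , x~w , y≁w , encw = Edge.enclosed-private x~y x~p y≁p y~q x≁q
        z , y~z , x≁z , encz = Edge.enclosed-private (∼-sym x~y) y~q x≁q x~p y≁p
    in Edge.not-enclosed x~y x~w y≁w encw y~z x≁z encz

  neighbourhoods-nested : ∀ {x y} → x ∼ y → (∀ v → N[ x ] v → N[ y ] v) ⊎ (∀ v → N[ y ] v → N[ x ] v)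
  neighbourhoods-nested {x} {y} x~y
    with any? (λ p → Closed? H x p ×-dec ¬? (Closed? H y p)) | any? (λ q → Closed? H y q ×-dec ¬? (Closed? H x q))
  ... | no none | _ = inj₁ λ v c → decidable-stable (Closed? H y v) (λ ¬c → none (v , c , ¬c))
  ... | yes _ | no none = inj₂ λ v c → decidable-stable (Closed? H x v) (λ ¬c → none (v , c , ¬c))
  ... | yes (_ , inj₁ refl , y≁x) | yes _ = ⊥-elim (y≁x (inj₂ (∼-sym x~y)))
  ... | yes (p , inj₂ x~p , y≁p) | yes (_ , inj₁ refl , x≁y) = ⊥-elim (x≁y (inj₂ x~y))
  ... | yes (p , inj₂ x~p , y≁p) | yes (q , inj₂ y~q , x≁q) = ⊥-elim (no-crossing-edge x~y x~p y≁p y~q x≁q)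

  -- Because of `v` the nesting can only go from `x` up to `y`, and it is strict.
  escape⇒deg⁺< : ∀ {x y v} → x ∼ y → v ∼ y → ¬ N[ x ] v → suc (deg⁺ H x) ≤ deg⁺ H y
  escape⇒deg⁺< {x} {y} x~y v~y x≁v =
    [ (λ N[x]⊆N[y] → count-insert (Closed? H x) (Closed? H y) N[x]⊆N[y] x≁v (inj₂ (∼-sym v~y)))
    , (λ N[y]⊆N[x] → ⊥-elim (x≁v (N[y]⊆N[x] _ (inj₂ (∼-sym v~y))))) ]′ (neighbourhoods-nested x~y)

  -- If `x` has no enclosed neighbour, then `y` has a neighbour outside `N[ x ]`, so its closed
  -- degree exceeds that of `x`, which is at least `m - 1`.
  maximal-vertex : ∀ {x y} → x ∼ y → ∃ λ s → ∃ (s ∼_) × 2 + k ≤ deg⁺ H s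
  maximal-vertex {x} {y} x~y with split-neighbours x
  ... | inj₁ (z , x~z , enc) = x , (z , x~z) , enclosed⇒m≤deg⁺ x x~z enc
  ... | inj₂ escape with escape y x~y
  ...   | v , v~y , x≁v = y , (x , ∼-sym x~y) , ≤-trans (s≤s (m≤1+deg⁺ x x~y)) (escape⇒deg⁺< x~y v~y x≁v)

  -- An edge from `u` leaving `N[ s ]` would give `u` a closed degree above `m`.
  maximal⇒closed : ∀ {s} → 2 + k ≤ deg⁺ H s → ∀ {u v} → N[ s ] u → u ∼ v → N[ s ] v
  maximal⇒closed m≤deg (inj₁ refl) u~v = inj₂ u~v
  maximal⇒closed {s} m≤deg {u} {v} (inj₂ s~u) u~v = decidable-stable (Closed? H s v) λ s≁v →
    <-irrefl refl (≤-trans (s≤s m≤deg) (≤-trans (escape⇒deg⁺< s~u (∼-sym u~v) s≁v) (deg⁺≤m u)))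

  maximal⇒universal : Connected H → ∀ {s} → 2 + k ≤ deg⁺ H s → ∀ v → N[ s ] v
  maximal⇒universal conn {s} m≤deg v = along (conn s v) (inj₁ refl)
    where
    along : ∀ {u v} → Walk H u v → N[ s ] u → N[ s ] v
    along here          c = c
    along (step u~w wk) c = along wk (maximal⇒closed m≤deg c u~w)

  universal⇒order : ∀ {s} → 2 + k ≤ deg⁺ H s → (∀ v → N[ s ] v) → n ≡ 2 + k
  universal⇒order {s} m≤deg univ = trans (≡-sym (count-all (Closed? H s) univ)) (≤-antisym (deg⁺≤m s) m≤deg)

  -- Non-adjacent pairs beside a universal vertex

  module NonAdjacent (n≡m : n ≡ 2 + k) {s : V} (univ : ∀ v → N[ s ] v) where

    module _ {a b : V} (a≢b : a ≢ b) (a≁b : ¬ a ∼ b) where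

      s≢a : s ≢ a
      s≢a refl = [ a≢b , a≁b ]′ (univ b)

      s∼a : s ∼ a
      s∼a = [ ⊥-elim ∘ s≢a , id ]′ (univ a)

      -- Two non-neighbours `b` and `x` would leave `a` with closed degree at most `m - 2`, below
      -- the minimum `m - 1`.
      unique-nonneighbour : ∀ {x} → x ≢ a → x ≢ b → a ∼ x
      unique-nonneighbour {x} x≢a x≢b = decidable-stable (Adj? H a x) λ a≁x → n≮n (2 + k) (begin-strict
        2 + k                                              ≤⟨ s≤s (m≤1+deg⁺ a (∼-sym s∼a)) ⟩
        1 + deg⁺ H a                                       ≤⟨ count-insert (Closed? H a) (λ v → Closed? H a v ⊎-dec v ≟ b) (λ _ → inj₁) [ a≢b , a≁b ]′ (inj₂ refl) ⟩
        count (λ v → Closed? H a v ⊎-dec v ≟ b)            <⟨ count-insert (λ v → Closed? H a v ⊎-dec v ≟ b) allV? {x} _ [ [ x≢a ∘ ≡-sym , a≁x ]′ , x≢b ]′ tt ⟩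
        count allV?                                        ≡⟨ trans (count-all allV? _) n≡m ⟩
        2 + k                                              ∎)
        where open ≤-Reasoning

    module _ {a b : V} (a≢b : a ≢ b) (a≁b : ¬ a ∼ b) where

      private
        b≢a : b ≢ a
        b≢a = a≢b ∘ ≡-sym

        b≁a : ¬ b ∼ a
        b≁a = a≁b ∘ ∼-sym

      -- A vertex `v` missed by `x` is neither `a` nor `b`, hence adjacent to `a`. Then `b` and `v`
      -- show that the closed neighbourhoods of `x` and `a` are not nested.
      others-universal : ∀ {x} → x ≢ a → x ≢ b → ∀ v → N[ x ] v
      others-universal {x} x≢a x≢b v = decidable-stable (Closed? H x v) λ x≁v →
        no-crossing-edge x~a x~b [ a≢b , a≁b ]′
          (unique-nonneighbour a≢b a≁b (λ { refl → x≁v (inj₂ x~a) }) (λ { refl → x≁v (inj₂ x~b) })) x≁v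
        where
        x~a : x ∼ a
        x~a = ∼-sym (unique-nonneighbour a≢b a≁b x≢a x≢b)
        x~b : x ∼ b
        x~b = ∼-sym (unique-nonneighbour b≢a b≁a x≢b x≢a)

      only-three : ∀ {x} → x ≢ s → x ≢ a → ¬ x ≢ b
      only-three {x} x≢s x≢a x≢b = n≮n (2 + k) (begin-strict
        2 + k                                               <⟨ n<1+n (2 + k) ⟩
        2 + suc k                                           ≡⟨ cong₂ _+_ (count-pair a≢b) (trans (cong (suc k *_) (count-singleton x)) (*-identityʳ (suc k))) ⟨
        count A? + suc k * count (_≟ x)                     ≤⟨ private-bound A? (_≟ x) dom A? (_≟ x) priv₀ priv₊ ⟩
        n                                                   ≡⟨ n≡m ⟩
        2 + k                                               ∎)
        where
        open ≤-Reasoning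
        A : V → Set
        A h = h ≡ a ⊎ h ≡ b
        A? : Decidable A
        A? h = h ≟ a ⊎-dec h ≟ b
        dom : TwoLevelDominating H A (_≡ x)
        dom h with A? h
        ... | yes Ah = inj₁ (inj₁ Ah)
        ... | no ¬Ah = [ (λ x≡h → inj₁ (inj₂ (≡-sym x≡h)))
                       , (λ x~h → inj₂ ((a , inj₁ refl , unique-nonneighbour a≢b a≁b (¬Ah ∘ inj₁) (¬Ah ∘ inj₂)) , (x , refl , x~h)))
                       ]′ (others-universal x≢a x≢b h)
        priv₀ : ∀ h → A h → A h × Private₀ H A (_≡ x) h
        priv₀ h (inj₁ refl) = inj₁ refl , noA (x≢a ∘ ≡-sym) (λ { _ (inj₁ refl) → Adj-irrefl H ; _ (inj₂ refl) → b≁a })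
        priv₀ h (inj₂ refl) = inj₂ refl , noA (x≢b ∘ ≡-sym) (λ { _ (inj₁ refl) → a≁b ; _ (inj₂ refl) → Adj-irrefl H })
        priv₊ : ∀ h → h ≡ x → h ≡ x × Private₊ H A (_≡ x) h
        -- `(i, s)` is private to `(i, x)`, as `s` differs from `a`, `b` and `x`.
        priv₊ h refl = refl , s , [ s≢a a≢b a≁b , s≢a b≢a b≁a ]′ , x≢s ∘ ≡-sym , λ _ b≡x _ → b≡x

      one-of-three : ∀ h → h ≡ s ⊎ (h ≡ a ⊎ h ≡ b)
      one-of-three h = decidable-stable (h ≟ s ⊎-dec (h ≟ a ⊎-dec h ≟ b))
        λ none → only-three (none ∘ inj₁) (none ∘ inj₂ ∘ inj₁) (none ∘ inj₂ ∘ inj₂)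

      order≡3 : n ≡ 3
      order≡3 = trans (≡-sym (count-all three? one-of-three)) (≤-antisym
        (≤-trans (count-∪-≤ (_≟ s) (λ h → h ≟ a ⊎-dec h ≟ b)) (≤-reflexive (cong₂ _+_ (count-singleton s) (count-pair a≢b))))
        (subst (λ j → suc j ≤ count three?) (count-pair a≢b)
          (count-insert (λ h → h ≟ a ⊎-dec h ≟ b) three? (λ _ → inj₂) [ s≢a a≢b a≁b , s≢a b≢a b≁a ]′ (inj₁ refl))))
        where
        three? : Decidable (λ h → h ≡ s ⊎ (h ≡ a ⊎ h ≡ b))
        three? h = h ≟ s ⊎-dec (h ≟ a ⊎-dec h ≟ b)

      path₃ : Path₃ H
      path₃ = record
        { centre = s ; left = a ; right = b
        ; centre~left = s∼a a≢b a≁b ; centre~right = s∼a b≢a b≁a ; left≁right = a≁b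
        ; exhaust = one-of-three ; left≢right = a≢b }

  classify : Connected H → 2 ≤ n → (n ≡ 2 + k × (∀ u v → u ≢ v → u ∼ v)) ⊎ (2 + k ≡ 3 × Path₃ H)
  classify conn 2≤n =
    let u , v , u≢v = two-elements 2≤n
        _ , u~w = first-edge H u≢v (conn u v)
        s , _ , m≤deg = maximal-vertex u~w
        univ = maximal⇒universal conn m≤deg
    in decide (universal⇒order m≤deg univ) univ
      (any? (λ a → any? (λ b → ¬? (a ≟ b) ×-dec ¬? (Adj? H a b))))
    where
    decide : n ≡ 2 + k → ∀ {s} → (∀ v → N[ s ] v) → Dec (∃₂ λ a b → a ≢ b × ¬ a ∼ b) →
      (n ≡ 2 + k × (∀ u v → u ≢ v → u ∼ v)) ⊎ (2 + k ≡ 3 × Path₃ H)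
    decide n≡m univ (yes (a , b , a≢b , a≁b)) =
      inj₂ (trans (≡-sym n≡m) (NonAdjacent.order≡3 n≡m univ a≢b a≁b) , NonAdjacent.path₃ n≡m univ a≢b a≁b)
    decide n≡m univ (no none) =
      inj₁ (n≡m , λ u v u≢v → decidable-stable (Adj? H u v) λ u≁v → none (u , v , u≢v , u≁v))

-- Sufficiency

sum-one : ∀ {n} {f : Fin n → ℕ} → (∀ i → f i ≡ 1) → sum f ≡ n
sum-one {n} f≡1 = trans (sum-cong-≗ f≡1) (trans (sum-const n 1) (*-identityʳ n))

module _ {m n : ℕ} where

  transversal : (Fin n → Fin m) → Subset (m * n)
  transversal f = select {m} {n} (λ g h → g ≟ f h)

  ∣transversal∣ : ∀ f → ∣ transversal f ∣ ≡ n
  ∣transversal∣ f = trans (∣select∣ (λ g h → g ≟ f h))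
    (trans (∑-comm (λ g h → ind (does (g ≟ f h)))) (sum-one (λ h → count-singleton (f h))))

  graph : (Fin m → Fin n) → Subset (m * n)
  graph f = select {m} {n} (λ g h → h ≟ f g)

  ∣graph∣ : ∀ f → ∣ graph f ∣ ≡ m
  ∣graph∣ f = trans (∣select∣ (λ g h → h ≟ f g)) (sum-one (λ g → count-singleton (f g)))

module Backward {m : ℕ} (H : Graph) (n≡m : order H ≡ m) where

  private
    X : Graph
    X = K m □ H

  Cover : Subset (order X) → Fin (order H) → Fin m → Fin (order H) → Set
  Cover D h g h′ = combine g h′ ∈ D × Adj H h′ h

  -- In a missed fibre nothing dominates along the fibre, so each `(g, h)` is dominated inside its
  -- own layer.
  fibres : ∀ {D} → Dominating X D → (∀ h → ∃ λ g → combine {m} g h ∈ D) ⊎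
    (∃ λ h → ¬ (∃ λ g → combine {m} g h ∈ D) × (∀ g → ∃ (Cover D h g)))
  fibres {D} dom with all? (λ h → any? (λ g → combine {m} g h ∈? D))
  ... | yes met = inj₁ met
  ... | no ¬met with ¬∀⟶∃¬ _ _ (λ h → any? (λ g → combine {m} g h ∈? D)) ¬met
  ...   | h , missed = inj₂ (h , missed , λ g → covered g (dominating□⁻ H dom g h))
    where
    covered : ∀ g → (∃₂ λ g′ h′ → combine g′ h′ ∈ D × Closed□ H g′ h′ g h) → ∃ (Cover D h g)
    covered g (g′ , _ , v∈D , fibre)       = ⊥-elim (missed (g′ , v∈D))
    covered g (_ , h′ , v∈D , layer h′~h) = h′ , v∈D , h′~h

  -- If all fibres are met, one vertex from each suffices. Only a missed fibre involves the
  -- structure of `H`; `repair` must then choose one vertex per layer.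
  wellDominated : (∀ D → Dominating X D → ∀ h → ¬ (∃ λ g → combine {m} g h ∈ D) → (∀ g → ∃ (Cover D h g)) →
      ∃ λ f → (∀ g → combine g (f g) ∈ D) × (∀ g h′ → ∃ λ g′ → Closed□ {m} H g′ (f g′) g h′)) →
    WellDominated X
  wellDominated repair = wellDominated⁺ X m
      (λ D dom → let E , E⊆D , _ , ∣E∣≡m = reduce D dom in subst (_≤ ∣ D ∣) ∣E∣≡m (p⊆q⇒∣p∣≤∣q∣ E⊆D))
      (λ D min → reduce D (proj₁ min))
    where
    reduce : ∀ D → Dominating X D → ∃ λ E → E ⊆ D × Dominating X E × ∣ E ∣ ≡ m
    reduce D dom with fibres dom
    ... | inj₁ met = transversal f
      , select⊆ {m} (λ g h → g ≟ f h) (λ { {_} {h} refl → proj₂ (met h) })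
      , select-dominating H (λ g h → g ≟ f h) (λ g h → f h , h , refl , fibre)
      , trans (∣transversal∣ f) n≡m
      where
      f : Fin (order H) → Fin m
      f = proj₁ ∘ met
    ... | inj₂ (h , missed , covers) with repair D dom h missed covers
    ...   | f , f∈D , dominates = graph f
      , select⊆ {m} (λ g h → h ≟ f g) (λ { {g} refl → f∈D g })
      , select-dominating H (λ g h → h ≟ f g) (λ g h → let g′ , c = dominates g h in g′ , f g′ , refl , c)
      , ∣graph∣ f

-- Prescribing two values lets a choice of one vertex per layer meet both leaf fibres of a path.
choose-through : {m n : ℕ} {Good : Fin m → Fin n → Set} → (∀ g → ∃ (Good g)) →
  ∀ {g₁ g₂ h₁ h₂} → g₁ ≢ g₂ → Good g₁ h₁ → Good g₂ h₂ →
  ∃ λ f → (∀ g → Good g (f g)) × f g₁ ≡ h₁ × f g₂ ≡ h₂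
choose-through {Good = Good} good {g₁} {g₂} {h₁} {h₂} g₁≢g₂ good₁ good₂ =
  proj₁ ∘ pick , proj₁ ∘ proj₂ ∘ pick , proj₁ (proj₂ (proj₂ (pick g₁))) refl , proj₂ (proj₂ (proj₂ (pick g₂))) refl
  where
  pick : ∀ g → ∃ λ h → Good g h × (g ≡ g₁ → h ≡ h₁) × (g ≡ g₂ → h ≡ h₂)
  pick g with g ≟ g₁ | g ≟ g₂
  ... | yes refl | _        = h₁ , good₁ , (λ _ → refl) , ⊥-elim ∘ g₁≢g₂
  ... | no  g≢g₁ | yes refl = h₂ , good₂ , ⊥-elim ∘ g≢g₁ , (λ _ → refl)
  ... | no  g≢g₁ | no g≢g₂  = proj₁ (good g) , proj₂ (good g) , ⊥-elim ∘ g≢g₁ , ⊥-elim ∘ g≢g₂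

-- The complete graph and the path

complete-wellDominated : (H : Graph) → (∀ u v → u ≢ v → Adj H u v) → WellDominated (K (order H) □ H)
complete-wellDominated H complete = Backward.wellDominated H refl λ D dom h missed covers →
  -- Any choice works, as a single vertex dominates its whole layer.
  let f = proj₁ ∘ covers in f , (λ g → proj₁ (proj₂ (covers g))) , λ g h′ → g , closed (f g) h′
  where
  closed : ∀ {g : Fin (order H)} h h′ → Closed□ H g h g h′
  closed h h′ with h ≟ h′
  ... | yes refl = fibre
  ... | no h≢h′  = layer (complete h h′ h≢h′)

reverse : ∀ {H} → Path₃ H → Path₃ H
reverse {H} path = record
  { centre = centre ; left = right ; right = left ; centre~left = centre~right ; centre~right = centre~left
  ; left≁right = left≁right ∘ Adj-sym H ; left≢right = left≢right ∘ ≡-sym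
  ; exhaust = λ h → [ inj₁ , [ inj₂ ∘ inj₂ , inj₂ ∘ inj₁ ]′ ]′ (exhaust h) }
  where open Path₃ path

left-neighbour : ∀ {H} (path : Path₃ H) {h} → Adj H h (Path₃.left path) → h ≡ Path₃.centre path
left-neighbour {H} path {h} h~a with Path₃.exhaust path h
... | inj₁ h≡s           = h≡s
... | inj₂ (inj₁ refl) = ⊥-elim (Adj-irrefl H h~a)
... | inj₂ (inj₂ refl) = ⊥-elim (Path₃.left≁right path (Adj-sym H h~a))

module _ {H : Graph} (n≡3 : order H ≡ 3) where

  open Backward H n≡3 using (Cover)

  private
    X : Graph
    X = K 3 □ H

    Missed : Subset (order X) → Fin (order H) → Set
    Missed D h = ¬ (∃ λ (g : Fin 3) → combine g h ∈ D)

    Repaired : Subset (order X) → Set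
    Repaired D = ∃ λ (f : Fin 3 → Fin (order H)) → (∀ (g : Fin 3) → combine g (f g) ∈ D) × (∀ (g : Fin 3) h → ∃ λ g′ → Closed□ H g′ (f g′) g h)

  -- The centre is the only neighbour of a leaf, so a missed leaf fibre forces the centre into `D`
  -- in every layer, which it dominates.
  missed-left : (path : Path₃ H) → ∀ D → (∀ g → ∃ (Cover D (Path₃.left path) g)) → Repaired D
  missed-left path D covers = (λ _ → centre) , centre∈D , λ g h → g , closed h
    where
    open Path₃ path
    centre∈D : ∀ (g : Fin 3) → combine g centre ∈ D
    centre∈D g with covers g
    ... | h , v∈D , h~a = subst (λ h → combine g h ∈ D) (left-neighbour path h~a) v∈D
    closed : ∀ {g : Fin 3} h → Closed□ H g centre g h
    closed h with exhaust h
    ... | inj₁ refl        = fibre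
    ... | inj₂ (inj₁ refl) = layer centre~left
    ... | inj₂ (inj₂ refl) = layer centre~right

  -- In layer zero, an arbitrary choice, the leaf has only the missed centre as a neighbour, so it
  -- is dominated along its fibre.
  leaf-met : (path : Path₃ H) → ∀ D → Dominating X D → Missed D (Path₃.centre path) →
    ∃ λ (g : Fin 3) → combine g (Path₃.left path) ∈ D
  leaf-met path D dom missed with dominating□⁻ H dom zero (Path₃.left path)
  ... | g , _ , v∈D , fibre      = g , v∈D
  ... | g , h , v∈D , layer h~a = ⊥-elim (missed (g , subst (λ h → combine g h ∈ D) (left-neighbour path h~a) v∈D))

  another : (g : Fin 3) → ∃ λ g′ → g ≢ g′
  another zero    = suc zero , λ ()
  another (suc _) = zero , λ ()

  -- One leaf per layer dominates all copies of the centre; both leaves must be used so that both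
  -- leaf fibres are met.
  missed-centre : (path : Path₃ H) → ∀ D → Dominating X D → Missed D (Path₃.centre path) →
    (∀ g → ∃ (Cover D (Path₃.centre path) g)) → Repaired D
  missed-centre path D dom missed covers with leaf-met path D dom missed | leaf-met (reverse path) D dom missed
  ... | ga , a∈D | gb , b∈D = separate
    where
    open Path₃ path
    good-left : ∀ (g : Fin 3) → combine g left ∈ D → Cover D centre g left
    good-left _ v∈D = v∈D , Adj-sym H centre~left
    good-right : ∀ (g : Fin 3) → combine g right ∈ D → Cover D centre g right
    good-right _ v∈D = v∈D , Adj-sym H centre~right
    through : ∀ {ga gb} → ga ≢ gb → combine ga left ∈ D → combine gb right ∈ D → Repaired D
    through {ga} {gb} ga≢gb a∈D b∈D with choose-through covers ga≢gb (good-left ga a∈D) (good-right gb b∈D)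
    ... | f , good , fga≡a , fgb≡b = f , proj₁ ∘ good , dominates
      where
      dominates : ∀ (g : Fin 3) h → ∃ λ g′ → Closed□ H g′ (f g′) g h
      dominates g h with exhaust h
      ... | inj₁ refl        = g , layer (proj₂ (good g))
      ... | inj₂ (inj₁ refl) = ga , subst (λ h → Closed□ H ga h g left) (≡-sym fga≡a) fibre
      ... | inj₂ (inj₂ refl) = gb , subst (λ h → Closed□ H gb h g right) (≡-sym fgb≡b) fibre
    -- If both leaves are met in the same layer, any second layer covers the centre from one of the leaves.
    separate : Repaired D
    separate with ga ≟ gb
    ... | no ga≢gb = through ga≢gb a∈D b∈D
    ... | yes refl with another ga
    ...   | g′ , ga≢g′ with covers g′
    ...     | h , v∈D , h~s with exhaust h
    ...       | inj₁ refl        = ⊥-elim (Adj-irrefl H h~s)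
    ...       | inj₂ (inj₁ refl) = through (ga≢g′ ∘ ≡-sym) v∈D b∈D
    ...       | inj₂ (inj₂ refl) = through ga≢g′ a∈D v∈D

  path₃-wellDominated : Path₃ H → WellDominated X
  path₃-wellDominated path = Backward.wellDominated H n≡3 repair
    where
    repair : ∀ D → Dominating X D → ∀ h → Missed D h → (∀ g → ∃ (Cover D h g)) → Repaired D
    repair D dom h missed covers with Path₃.exhaust path h
    ... | inj₁ refl        = missed-centre path D dom missed covers
    ... | inj₂ (inj₁ refl) = missed-left path D covers
    ... | inj₂ (inj₂ refl) = missed-left (reverse path) D covers

-- Transfer along isomorphisms and the equivalence

≅K⇒complete : ∀ {H m} → H ≅ K m → ∀ u v → u ≢ v → Adj H u v
≅K⇒complete {H} {m} iso u v u≢v = subst T (pres u v)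
  (fromWitnessFalse {a? = to u ≟ to v} (λ eq → u≢v (trans (≡-sym (strictlyInverseʳ u)) (trans (cong from eq) (strictlyInverseʳ v)))))
  where
  open _≅_ iso
  open Inverse bij

≅P₃⇒path₃ : ∀ {H} → H ≅ P₃ → Path₃ H
≅P₃⇒path₃ {H} iso = record
  { centre = from (suc zero) ; left = from zero ; right = from (suc (suc zero))
  ; centre~left  = subst T (p3adj≡adj (suc zero) zero) tt
  ; centre~right = subst T (p3adj≡adj (suc zero) (suc (suc zero))) tt
  ; left≁right   = subst T (≡-sym (p3adj≡adj zero (suc (suc zero))))
  ; left≢right   = λ eq → 0≢2 (trans (≡-sym (strictlyInverseˡ zero)) (trans (cong to eq) (strictlyInverseˡ (suc (suc zero)))))
  ; exhaust      = λ h → image h (to h) (≡-sym (strictlyInverseʳ h))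
  }
  where
  open _≅_ iso
  open Inverse bij
  0≢2 : _≢_ {A = Fin 3} zero (suc (suc zero))
  0≢2 ()
  p3adj≡adj : ∀ i j → p3adj i j ≡ adj H (from i) (from j)
  p3adj≡adj i j = trans (≡-sym (cong₂ p3adj (strictlyInverseˡ i) (strictlyInverseˡ j))) (pres (from i) (from j))
  image : ∀ h i → h ≡ from i → h ≡ from (suc zero) ⊎ (h ≡ from zero ⊎ h ≡ from (suc (suc zero)))
  image h zero             eq = inj₂ (inj₁ eq)
  image h (suc zero)       eq = inj₁ eq
  image h (suc (suc zero)) eq = inj₂ (inj₂ eq)

≅⇒order≡ : ∀ {X Y} → X ≅ Y → order X ≡ order Y
≅⇒order≡ iso = ↔⇒≡ (_≅_.bij iso)

≅K⇒wellDominated : ∀ {m H} → H ≅ K m → WellDominated (K m □ H)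
≅K⇒wellDominated {m} {H} iso =
  subst (λ j → WellDominated (K j □ H)) (≅⇒order≡ iso) (complete-wellDominated H (≅K⇒complete iso))

theorem3 : (m : ℕ) → 2 ≤ m → (H : Graph) → Connected H → 2 ≤ order H →
    WellDominated (K m □ H) ⇔ ((¬ (m ≡ 3) × H ≅ K m) ⊎ (m ≡ 3 × (H ≅ K 3 ⊎ H ≅ P₃)))
theorem3 (suc (suc k)) (s≤s (s≤s z≤n)) H conn 2≤n = mk⇔ forward backward
  where
  forward : WellDominated (K (2 + k) □ H) →
    (¬ (2 + k ≡ 3) × H ≅ K (2 + k)) ⊎ (2 + k ≡ 3 × (H ≅ K 3 ⊎ H ≅ P₃))
  forward wd = [ (λ (n≡m , complete) → isComplete (subst (λ j → H ≅ K j) n≡m (complete⇒≅K H complete)) (2 + k ℕ.≟ 3))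
               , (λ (m≡3 , path) → inj₂ (m≡3 , inj₂ (path₃⇒≅P₃ H path))) ]′ (Forward.classify k H wd conn 2≤n)
    where
    -- `K 3` is listed together with `P₃`, so the complete case splits on `m = 3`.
    isComplete : H ≅ K (2 + k) → Dec (2 + k ≡ 3) → (¬ (2 + k ≡ 3) × H ≅ K (2 + k)) ⊎ (2 + k ≡ 3 × (H ≅ K 3 ⊎ H ≅ P₃))
    isComplete iso (yes m≡3) = inj₂ (m≡3 , inj₁ (subst (λ j → H ≅ K j) m≡3 iso))
    isComplete iso (no  m≢3) = inj₁ (m≢3 , iso)

  backward : (¬ (2 + k ≡ 3) × H ≅ K (2 + k)) ⊎ (2 + k ≡ 3 × (H ≅ K 3 ⊎ H ≅ P₃)) → WellDominated (K (2 + k) □ H)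
  backward (inj₁ (_ , iso))           = ≅K⇒wellDominated iso
  backward (inj₂ (refl , inj₁ iso)) = ≅K⇒wellDominated iso
  backward (inj₂ (refl , inj₂ iso)) = path₃-wellDominated (≅⇒order≡ iso) (≅P₃⇒path₃ iso)
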